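{- Let $u$ be a nonprincipal ultrafilter on $\mathbb{Z}$ that is $\mathbb{Z}$-Ramsey and is also a P-point. Then $u$ is a selective ultrafilter.
   Context: A colouring $c:[\mathbb{Z}]^2\to 2$ (where $[\mathbb{Z}]^2$ is the set of 2-element subsets of $\mathbb{Z}$ and $2=\{0,1\}$) is $\mathbb{Z}$-invariant if $c(\{x,y\})=c(\{x+z,y+z\})$ for all distinct $x,y\in\mathbb{Z}$ and all $z\in\mathbb{Z}$. An ultrafilter $u$ on $\mathbb{Z}$ is $\mathbb{Z}$-Ramsey if for every $\mathbb{Z}$-invariant colouring $c:[\mathbb{Z}]^2\to 2$ there is $A\in u$ such that $c$ is constant on $[A]^2$. A nonprincipal ultrafilter $u$ on a countable set $S$ is a P-point if every function $f:S\to\omega$ is constant or finite-to-one on some element of $u$. A nonprincipal ultrafilter $u$ on a countable set $S$ is selective (equivalently, Ramsey) if for every partition of $S$, either some piece of the partition belongs to $u$ or there is $A\in u$ meeting each piece in at most one point. -}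

module Defs where

open import Data.Fin.Base using (Fin)
open import Data.Integer.Base using (ℤ; _+_)
open import Data.List.Base using (List)
import Data.List.Membership.Propositional as List
open import Data.Nat.Base using (ℕ)
open import Data.Product.Base using (∃; ∃-syntax; _×_)
open import Data.Sum.Base using (_⊎_)
open import Function.Bundles using (_⇔_)
open import Level using (Level; 0ℓ; _⊔_) renaming (suc to lsuc)
open import Relation.Binary.PropositionalEquality.Core using (_≡_; _≢_)
open import Relation.Nullary.Negation.Core using (¬_)
open import Relation.Unary using (Pred; _∈_; _⊆_; _≐_; _∩_; _⊥_; U; ∁; Satisfiable)

-- Subsets of S are predicates S → Set.  Closure under ⊆ makes `sets` respect
-- extensional equality ≐ of subsets.  Properness is stated as inhabitation of
-- every member; applied to the constant predicates λ _ → P, it combines with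
-- `ultra` to decide every P : Set, so working with an ultrafilter is working
-- classically at that level.
record Ultrafilter (S : Set) (ℓ : Level) : Set (lsuc 0ℓ ⊔ lsuc ℓ) where
  field
    sets         : Pred (Pred S 0ℓ) ℓ
    universe     : U ∈ sets
    upward       : ∀ {A B} → A ⊆ B → A ∈ sets → B ∈ sets
    intersection : ∀ {A B} → A ∈ sets → B ∈ sets → A ∩ B ∈ sets
    proper       : ∀ {A} → A ∈ sets → Satisfiable A
    ultra        : ∀ A → A ∈ sets ⊎ ∁ A ∈ sets

open Ultrafilter public

Nonprincipal : ∀ {S ℓ} → Ultrafilter S ℓ → Set (lsuc 0ℓ ⊔ ℓ)
Nonprincipal u = ¬ (∃[ x ] ∀ A → A ∈ sets u ⇔ x ∈ A)

-- A function [S]² → 2: the value depends neither on the order of the two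
-- points nor on the (irrelevant) proof that they are distinct.
record Colouring (S : Set) : Set where
  field
    colour    : ∀ (x y : S) → .(x ≢ y) → Fin 2
    symmetric : ∀ (x y : S) .(x≢y : x ≢ y) .(y≢x : y ≢ x) →
                colour x y x≢y ≡ colour y x y≢x

open Colouring public

ConstantOnPairs : ∀ {S} → Colouring S → Pred S 0ℓ → Set
ConstantOnPairs c A =
  ∃[ k ] ∀ x y → x ∈ A → y ∈ A → (x≢y : x ≢ y) → colour c x y x≢y ≡ k

ℤ-Invariant : Colouring ℤ → Set
ℤ-Invariant c =
  ∀ (x y z : ℤ) .(x≢y : x ≢ y) .(x+z≢y+z : x + z ≢ y + z) →
  colour c x y x≢y ≡ colour c (x + z) (y + z) x+z≢y+z

ℤ-Ramsey : ∀ {ℓ} → Ultrafilter ℤ ℓ → Set (lsuc 0ℓ ⊔ ℓ)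
ℤ-Ramsey u =
  ∀ c → ℤ-Invariant c → ∃[ A ] (A ∈ sets u × ConstantOnPairs c A)

Finite : ∀ {S : Set} → Pred S 0ℓ → Set
Finite {S} P = ∃[ xs ] P ≐ (List._∈ xs)

ConstantOn : ∀ {S : Set} → (S → ℕ) → Pred S 0ℓ → Set
ConstantOn f A = ∃[ n ] ∀ x → x ∈ A → f x ≡ n

FiniteToOneOn : ∀ {S : Set} → (S → ℕ) → Pred S 0ℓ → Set
FiniteToOneOn f A = ∀ n → Finite (A ∩ (λ x → f x ≡ n))

P-Point : ∀ {S ℓ} → Ultrafilter S ℓ → Set (lsuc 0ℓ ⊔ ℓ)
P-Point {S} u =
  Nonprincipal u ×
  (∀ (f : S → ℕ) → ∃[ A ] (A ∈ sets u × (ConstantOn f A ⊎ FiniteToOneOn f A)))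

record Partition (S : Set) : Set₁ where
  field
    Index    : Set
    Piece    : Index → Pred S 0ℓ
    nonempty : ∀ i → Satisfiable (Piece i)
    disjoint : ∀ {i j} → i ≢ j → Piece i ⊥ Piece j
    covering : ∀ x → ∃[ i ] x ∈ Piece i

open Partition public

AtMostOne : ∀ {S : Set} → Pred S 0ℓ → Set
AtMostOne P = ∀ x y → x ∈ P → y ∈ P → x ≡ y

Selective : ∀ {S ℓ} → Ultrafilter S ℓ → Set (lsuc 0ℓ ⊔ ℓ)
Selective {S} u =
  Nonprincipal u ×
  (∀ (𝒫 : Partition S) →
     (∃[ i ] Piece 𝒫 i ∈ sets u) ⊎
     (∃[ A ] (A ∈ sets u × ∀ i → AtMostOne (A ∩ Piece 𝒫 i))))

{-# OPTIONS --safe #-}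

-- Fix, for every m, the residue class modulo m that lies in u, and let g(x) be
-- the least m for which x lies outside that class; let f(x) be the index of the
-- piece of x.  The P-point property applies to both: g is not constant on a set
-- in u, and if f is, then a piece lies in u.  Otherwise both are finite-to-one
-- on some A ∈ u, and there is a nondecreasing H with |y − x| ≤ H(m) whenever
-- x, y ∈ A, g(x) ≤ m and f(x) = f(y).  Colour a pair by whether its difference d
-- satisfies m ∤ d and H(m) < |d| for some m.  Fixing x and choosing y far away in
-- the class of modulus g(x) shows that a homogeneous set in u has the positive
-- colour.  If two of its points x ≠ y had f(x) = f(y) and g(x) ≤ g(y), then
-- every modulus below g(x) would divide y − x, so the m given by the colour is
-- at least g(x), and H(m) < |y − x| contradicts the choice of H.
module Submission where

open import Defs
open import Data.Fin.Base using (Fin; zero; suc)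
open import Data.Integer.Base using (ℤ; +_; -[1+_]; _+_; _-_; _*_; ∣_∣; 0ℤ)
open import Data.Integer.DivMod using (_%ℕ_; _/ℕ_; a≡a%ℕn+[a/ℕn]*n; n%ℕd<d)
open import Data.Integer.Divisibility.Signed using (_∣_; divides; ∣m∣n⇒∣m-n; ∣m+n∣m⇒∣n; ∣⇒∣ᵤ; ∣ᵤ⇒∣)
import Data.Integer.Properties as ℤ
open import Data.Integer.Tactic.RingSolver using (solve-∀)
open import Data.List.Base using (_∷_; map; upTo)
open import Data.List.Membership.Propositional using () renaming (_∈_ to _∈ₗ_)
open import Data.List.Membership.Propositional.Properties using (∈-upTo⁺)
open import Data.List.Relation.Unary.Any using (here; there)
open import Data.Nat.Base as ℕ using (ℕ; zero; suc; _≤_; _<_; z≤n; s≤s)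
open import Data.Nat.Divisibility using (>⇒∤) renaming (_∣_ to _∣ℕ_; _∤_ to _∤ℕ_)
open import Data.Nat.ListAction using (sum)
import Data.Nat.Properties as ℕ
open import Data.Product.Base using (∃; ∃-syntax; _×_; _,_; proj₁; proj₂)
open import Data.Sum.Base using (_⊎_; inj₁; inj₂)
open import Function.Base using (_∘_)
open import Function.Bundles using (mk⇔)
open import Level using (0ℓ)
open import Relation.Binary.PropositionalEquality
open import Relation.Nullary using (¬_; Dec; yes; no; contradiction)
open import Relation.Nullary.Decidable using (decidable-stable)
open import Relation.Unary using (Pred; _∈_; _∉_; _∩_; ∁; Satisfiable; Decidable)

-- Bounds by sums, least elements, an enumeration of the integers

∈⇒≤sum-map : ∀ {A : Set} (h : A → ℕ) {x xs} → x ∈ₗ xs → h x ≤ sum (map h xs)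
∈⇒≤sum-map h (here refl)        = ℕ.m≤m+n _ _
∈⇒≤sum-map h {xs = y ∷ _} (there x∈xs) =
  ℕ.≤-trans (∈⇒≤sum-map h x∈xs) (ℕ.m≤n+m _ (h y))

IsLeast : Pred ℕ 0ℓ → Pred ℕ 0ℓ
IsLeast P n = P n × (∀ {j} → P j → n ≤ j)

-- Bounded search: the second outcome of `search n` says that no element lies below `n`, which the
-- witness `w` refutes at `suc w`.
least : ∀ {P : Pred ℕ 0ℓ} → Decidable P → Satisfiable P → ∃ (IsLeast P)
least {P} P? (w , Pw) with search (suc w)
  where
  search : ∀ n → ∃ (IsLeast P) ⊎ (∀ {j} → P j → n ≤ j)
  search zero = inj₂ λ _ → z≤n
  search (suc n) with search n
  ... | inj₁ found = inj₁ found
  ... | inj₂ below with P? n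
  ...   | yes Pn = inj₁ (n , Pn , below)
  ...   | no ¬Pn = inj₂ λ Pj → ℕ.≤∧≢⇒< (below Pj) λ { refl → ¬Pn Pj }
... | inj₁ found = found
... | inj₂ w<    = contradiction (w< Pw) ℕ.1+n≰n

next : ℤ → ℤ
next (+ n)    = -[1+ n ]
next -[1+ n ] = + suc n

-- 0, −1, 1, −2, 2, …
enum : ℕ → ℤ
enum zero    = 0ℤ
enum (suc n) = next (enum n)

enum-surjective : ∀ x → ∃[ n ] enum n ≡ x
enum-surjective = λ { (+ n) → nonneg n ; -[1+ n ] → neg n }
  where
  nonneg : ∀ n → ∃[ m ] enum m ≡ + n
  neg    : ∀ n → ∃[ m ] enum m ≡ -[1+ n ]
  nonneg zero = 0 , refl
  nonneg (suc n) with neg n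
  ... | m , eq = suc m , cong next eq
  neg n with nonneg n
  ... | m , eq = suc m , cong next eq

-- Classical reasoning and finite partitions inside an ultrafilter

module UltrafilterProperties {S : Set} {ℓ} (u : Ultrafilter S ℓ) where

  excluded-middle : (P : Set) → Dec P
  excluded-middle P with ultra u (λ _ → P)
  ... | inj₁ P∈u  = yes (proj₂ (proper u P∈u))
  ... | inj₂ ¬P∈u = no (proj₂ (proper u ¬P∈u))

  -- The value is junk when P is empty.
  min : (P : Pred ℕ 0ℓ) → ∃[ n ] (Satisfiable P → IsLeast P n)
  min P with excluded-middle (∃ P)
  ... | no ¬∃P = 0 , λ ∃P → contradiction ∃P ¬∃P
  ... | yes ∃P with least (λ n → excluded-middle (P n)) ∃P
  ...   | n , isLeast = n , λ _ → isLeast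

  pigeonhole : ∀ (f : S → ℕ) n → (λ x → f x < n) ∈ sets u → ∃[ r ] (λ x → f x ≡ r) ∈ sets u
  pigeonhole f zero f<0 with () ← proj₂ (proper u f<0)
  pigeonhole f (suc n) f<1+n with ultra u (λ x → f x ≡ n)
  ... | inj₁ f≡n = n , f≡n
  ... | inj₂ f≢n = pigeonhole f n
    (upward u (λ (fx<1+n , fx≢n) → ℕ.≤∧≢⇒< (ℕ.≤-pred fx<1+n) fx≢n) (intersection u f<1+n f≢n))

  ∁-singleton : Nonprincipal u → ∀ x → (_≢ x) ∈ sets u
  ∁-singleton u-nonprincipal x with ultra u (_≡ x)
  ... | inj₂ ≢x = ≢x
  ... | inj₁ ≡x = contradiction (x , λ A → mk⇔ (to A) (from A)) u-nonprincipal
    where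
    to : ∀ A → A ∈ sets u → x ∈ A
    to A A∈u with _ , y∈A , refl ← proper u (intersection u A∈u ≡x) = y∈A
    from : ∀ A → x ∈ A → A ∈ sets u
    from A x∈A = upward u (λ { refl → x∈A }) ≡x

-- Residue classes, balls and difference colourings

module _ {ℓ} (u : Ultrafilter ℤ ℓ) where

  open UltrafilterProperties u

  -- The index `m` stands for the modulus `suc m`, so modulus 0 never arises; one of the finitely
  -- many remainders has its fibre in `u`.
  residueClass : ∀ m → ∃[ r ] (λ x → + suc m ∣ x - r) ∈ sets u
  residueClass m
    with r , ≡r ← pigeonhole (_%ℕ suc m) (suc m) (upward u (λ {x} _ → n%ℕd<d x (suc m)) (universe u))
    = + r , upward u (λ {x} x≡r → divides (x /ℕ suc m) (lemma x x≡r)) ≡r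
    where
    cancel : ∀ a b → (a + b) - a ≡ b
    cancel = solve-∀
    lemma : ∀ x {r} → x %ℕ suc m ≡ r → x - + r ≡ (x /ℕ suc m) * + suc m
    lemma x refl = trans (cong (_- + (x %ℕ suc m)) (a≡a%ℕn+[a/ℕn]*n x (suc m)))
                         (cancel (+ (x %ℕ suc m)) _)

  -- Induction on the radius: only two points lie at distance `suc n` from `x`, and each can be
  -- removed.
  avoids-balls : Nonprincipal u → ∀ x n → (λ y → n < ∣ x - y ∣) ∈ sets u
  avoids-balls u-nonprincipal x zero =
    upward u (λ y≢x → ℕ.n≢0⇒n>0 λ eq → y≢x (sym (ℤ.i-j≡0⇒i≡j x _ (ℤ.∣i∣≡0⇒i≡0 eq))))
      (∁-singleton u-nonprincipal x)
  avoids-balls u-nonprincipal x (suc n) =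
    upward u (λ { (n< , ≢₁ , ≢₂) → ℕ.≤∧≢⇒< n< (excluded ≢₁ ≢₂) })
      (intersection u (avoids-balls u-nonprincipal x n)
        (intersection u (∁-singleton u-nonprincipal (x - + suc n))
                        (∁-singleton u-nonprincipal (x - -[1+ n ]))))
    where
    flip-sub : ∀ x y → y ≡ x - (x - y)
    flip-sub = solve-∀
    excluded : ∀ {y} → y ≢ x - + suc n → y ≢ x - -[1+ n ] → suc n ≢ ∣ x - y ∣
    excluded {y} ≢₁ ≢₂ eq with x - y in d
    excluded {y} ≢₁ ≢₂ refl | + _      = ≢₁ (trans (flip-sub x y) (cong (λ e → x - e) d))
    excluded {y} ≢₁ ≢₂ refl | -[1+ _ ] = ≢₂ (trans (flip-sub x y) (cong (λ e → x - e) d))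

  -- Distances are invariant under translation, so every property of distances gives an invariant
  -- colouring.
  homogeneous : ℤ-Ramsey u → (Q : Pred ℕ 0ℓ) →
    ∃[ A ] (A ∈ sets u ×
      ((∀ x y → x ∈ A → y ∈ A → x ≢ y → Q ∣ x - y ∣) ⊎
       (∀ x y → x ∈ A → y ∈ A → x ≢ y → ¬ Q ∣ x - y ∣)))
  homogeneous ramsey Q = conclude (ramsey c invariant)
    where
    indicator : ℕ → Fin 2
    indicator n with excluded-middle (Q n)
    ... | yes _ = suc zero
    ... | no _  = zero

    indicator≡1 : ∀ n → indicator n ≡ suc zero → Q n
    -- The answer `no` would make `eq` identify the two colours.
    indicator≡1 n eq with yes q ← excluded-middle (Q n) = q

    indicator≡0 : ∀ n → indicator n ≡ zero → ¬ Q n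
    indicator≡0 n eq with no ¬q ← excluded-middle (Q n) = ¬q

    c : Colouring ℤ
    c = record
      { colour    = λ x y _ → indicator ∣ x - y ∣
      ; symmetric = λ x y _ _ → cong indicator (ℤ.∣i-j∣≡∣j-i∣ x y)
      }

    translate : ∀ x y z → x - y ≡ (x + z) - (y + z)
    translate = solve-∀

    invariant : ℤ-Invariant c
    invariant x y z _ _ = cong (indicator ∘ ∣_∣) (translate x y z)

    conclude : ∃[ A ] (A ∈ sets u × ConstantOnPairs c A) → _
    conclude (A , A∈u , zero , const) =
      A , A∈u , inj₂ λ x y x∈A y∈A x≢y → indicator≡0 _ (const x y x∈A y∈A x≢y)
    conclude (A , A∈u , suc zero , const) =
      A , A∈u , inj₁ λ x y x∈A y∈A x≢y → indicator≡1 _ (const x y x∈A y∈A x≢y)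

  -- Opaque so that x can be inferred from the type x ∈ Class m.
  opaque
    Class : ℕ → Pred ℤ 0ℓ
    Class m x = + suc m ∣ x - proj₁ (residueClass m)

    Class∈u : ∀ m → Class m ∈ sets u
    Class∈u m = proj₂ (residueClass m)

    Class-∣ : ∀ {m x y} → x ∈ Class m → y ∈ Class m → suc m ∣ℕ ∣ x - y ∣
    Class-∣ {m} {x} {y} x∈ y∈ =
      ∣⇒∣ᵤ (subst (+ suc m ∣_) (cancel x y _) (∣m∣n⇒∣m-n x∈ y∈))
      where
      cancel : ∀ x y r → (x - r) - (y - r) ≡ x - y
      cancel = solve-∀

    Class-∤ : ∀ {m x y} → x ∉ Class m → y ∈ Class m → suc m ∤ℕ ∣ x - y ∣
    Class-∤ {m} {x} {y} x∉ y∈ m∣x-y =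
      x∉ (∣m+n∣m⇒∣n {m = y - x} (subst (+ suc m ∣_) (split x y _) y∈)
        (∣ᵤ⇒∣ (subst (suc m ∣ℕ_) (ℤ.∣i-j∣≡∣j-i∣ x y) m∣x-y)))
      where
      split : ∀ x y r → y - r ≡ (y - x) + (x - r)
      split = solve-∀

  -- The first residue class that a point leaves

  InAllClasses : Pred ℤ 0ℓ
  InAllClasses x = ∀ m → x ∈ Class m

  ∁InAllClasses∈u : Nonprincipal u → ∁ InAllClasses ∈ sets u
  ∁InAllClasses∈u u-nonprincipal with ultra u InAllClasses
  ... | inj₂ ∁∈u = ∁∈u
  ... | inj₁ all∈u with proper u all∈u
  ...   | x , x∈ with proper u (intersection u all∈u (avoids-balls u-nonprincipal x 0))
  ...     | y , y∈ , 0<d =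
    -- The index `∣ x - y ∣` stands for a modulus one larger than the distance, which cannot divide
    -- a positive distance.
    contradiction (Class-∣ (x∈ ∣ x - y ∣) (y∈ ∣ x - y ∣))
      (>⇒∤ {{ℕ.>-nonZero 0<d}} ℕ.≤-refl)

  -- The function g, as an index: the modulus is `suc (exit x)`. On `InAllClasses` it takes the
  -- default value 0.
  exit : ℤ → ℕ
  exit x = proj₁ (min λ m → x ∉ Class m)

  exit-isLeast : ∀ {x} → x ∉ InAllClasses → IsLeast (λ m → x ∉ Class m) (exit x)
  exit-isLeast {x} x∉all = proj₂ (min λ m → x ∉ Class m)
    (decidable-stable (excluded-middle _) λ ¬∃ →
      x∉all λ m → decidable-stable (excluded-middle _) λ x∉ → ¬∃ (m , x∉))

  exit-∉ : ∀ {x} → x ∉ InAllClasses → x ∉ Class (exit x)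
  exit-∉ = proj₁ ∘ exit-isLeast

  exit-∈ : ∀ {x j} → x ∉ InAllClasses → j < exit x → x ∈ Class j
  exit-∈ x∉all j< = decidable-stable (excluded-middle _) λ x∉ →
    ℕ.<⇒≱ j< (proj₂ (exit-isLeast x∉all) x∉)

  -- A constant value `m` is impossible: `Class m` is in `u`, so it meets the set outside
  -- `InAllClasses`, yet a point there with exit `m` lies outside `Class m`.
  exit-finiteToOne : P-Point u → ∃[ A ] (A ∈ sets u × FiniteToOneOn exit A)
  exit-finiteToOne (u-nonprincipal , pp) with pp exit
  ... | A , A∈u , inj₂ fin = A , A∈u , fin
  ... | A , A∈u , inj₁ (m , const)
    with y , y∈A , y∈m , y∉all ← proper u
           (intersection u A∈u (intersection u (Class∈u m) (∁InAllClasses∈u u-nonprincipal)))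
    = contradiction (subst (λ k → y ∈ Class k) (sym (const y y∈A)) y∈m) (exit-∉ y∉all)

  -- The colouring that separates the points of each fibre

  injectiveOn : ℤ-Ramsey u → P-Point u → ∀ {f A} → A ∈ sets u → FiniteToOneOn f A →
    ∃[ B ] (B ∈ sets u × (∀ x y → x ∈ B → y ∈ B → f x ≡ f y → x ≡ y))
  injectiveOn ramsey pp@(u-nonprincipal , _) {f} {A} A∈u f-fin
    with A′ , A′∈u , exit-fin ← exit-finiteToOne pp = select (homogeneous ramsey Q)
    where
    -- A sum serves in place of a maximum: it bounds the distance from `x` to each point of `A` in
    -- its fibre.
    spread : ℤ → ℕ
    spread x = sum (map (λ y → ∣ x - y ∣) (proj₁ (f-fin (f x))))

    -- `upTo (suc m)` runs through all exits up to and including `m`, and each of them has only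
    -- finitely many points in `A′`.
    H : ℕ → ℕ
    H m = sum (map (λ j → sum (map spread (proj₁ (exit-fin j)))) (upTo (suc m)))

    H-bound : ∀ {x y m} → x ∈ A′ → y ∈ A → f x ≡ f y → exit x ≤ m → ∣ x - y ∣ ≤ H m
    H-bound {x} {y} {m} x∈A′ y∈A fx≡fy exit≤m = begin
      ∣ x - y ∣
        ≤⟨ ∈⇒≤sum-map _ (proj₁ (proj₂ (f-fin (f x))) (y∈A , sym fx≡fy)) ⟩
      spread x
        ≤⟨ ∈⇒≤sum-map spread (proj₁ (proj₂ (exit-fin (exit x))) (x∈A′ , refl)) ⟩
      sum (map spread (proj₁ (exit-fin (exit x))))
        ≤⟨ ∈⇒≤sum-map _ (∈-upTo⁺ (s≤s exit≤m)) ⟩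
      H m ∎
      where open ℕ.≤-Reasoning

    Q : Pred ℕ 0ℓ
    Q d = ∃[ m ] (suc m ∤ℕ d × H m < d)

    Good : Pred ℤ 0ℓ
    Good = A ∩ A′ ∩ ∁ InAllClasses

    Good∈u : Good ∈ sets u
    Good∈u = intersection u A∈u (intersection u A′∈u (∁InAllClasses∈u u-nonprincipal))

    separated : ∀ {x y} → x ∈ Good → y ∈ Good → exit x ≤ exit y → Q ∣ x - y ∣ → f x ≢ f y
    separated (_ , x∈A′ , x∉all) (y∈A , _ , y∉all) exit≤ (m , m∤d , Hm<d) fx≡fy =
      ℕ.<⇒≱ Hm<d (H-bound x∈A′ y∈A fx≡fy (ℕ.≮⇒≥ λ m<exit →
        m∤d (Class-∣ (exit-∈ x∉all m<exit) (exit-∈ y∉all (ℕ.<-≤-trans m<exit exit≤)))))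

    select : ∃[ B ] (B ∈ sets u ×
      ((∀ x y → x ∈ B → y ∈ B → x ≢ y → Q ∣ x - y ∣) ⊎
       (∀ x y → x ∈ B → y ∈ B → x ≢ y → ¬ Q ∣ x - y ∣))) → _
    select (B , B∈u , inj₂ ¬Q) with proper u (intersection u B∈u (∁InAllClasses∈u u-nonprincipal))
    ... | x , x∈B , x∉all
      with y , y∈B , y∈m , far ← proper u (intersection u B∈u (intersection u (Class∈u (exit x))
             (avoids-balls u-nonprincipal x (H (exit x)))))
      = contradiction (exit x , Class-∤ (exit-∉ x∉all) y∈m , far)
          -- The points differ because `y` lies in the class that `x` leaves.
          (¬Q x y x∈B y∈B λ { refl → exit-∉ x∉all y∈m })
    select (B , B∈u , inj₁ allQ) = B ∩ Good , intersection u B∈u Good∈u , injective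
      where
      injective : ∀ x y → x ∈ B ∩ Good → y ∈ B ∩ Good → f x ≡ f y → x ≡ y
      injective x y (x∈B , x∈G) (y∈B , y∈G) fx≡fy = decidable-stable (x ℤ.≟ y) λ x≢y →
        case-≤ x≢y (ℕ.≤-total (exit x) (exit y))
        where
        case-≤ : x ≢ y → ¬ (exit x ≤ exit y ⊎ exit y ≤ exit x)
        case-≤ x≢y (inj₁ le) = separated x∈G y∈G le (allQ x y x∈B y∈B x≢y) fx≡fy
        case-≤ x≢y (inj₂ ge) = separated y∈G x∈G ge (allQ y x y∈B x∈B (x≢y ∘ sym)) (sym fx≡fy)

  -- Numbering the pieces of a partition

  module _ (𝒫 : Partition ℤ) where

    index : ℤ → Index 𝒫
    index x = proj₁ (covering 𝒫 x)

    -- Disjointness only refutes that the indices differ; excluded middle turns this into equality.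
    ∈Piece⇒index≡ : ∀ {i x} → x ∈ Piece 𝒫 i → index x ≡ i
    ∈Piece⇒index≡ {x = x} x∈i = decidable-stable (excluded-middle _) λ ≢i →
      disjoint 𝒫 ≢i (proj₂ (covering 𝒫 x) , x∈i)

    -- `Index 𝒫` is an arbitrary type, so a piece is numbered by the first place in the enumeration
    -- at which one of its points occurs.
    label : ℤ → ℕ
    label x = proj₁ (min λ n → index (enum n) ≡ index x)

    label-isLeast : ∀ x → IsLeast (λ n → index (enum n) ≡ index x) (label x)
    label-isLeast x with n , enum≡x ← enum-surjective x =
      proj₂ (min λ n → index (enum n) ≡ index x) (n , cong index enum≡x)

    label-mono : ∀ {x y} → index x ≡ index y → label x ≤ label y
    label-mono {x} {y} eq =
      proj₂ (label-isLeast x) (trans (proj₁ (label-isLeast y)) (sym eq))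

    label-cong : ∀ {x y} → index x ≡ index y → label x ≡ label y
    label-cong eq = ℕ.≤-antisym (label-mono eq) (label-mono (sym eq))

    label≡⇒∈Piece : ∀ {x n} → label x ≡ n → x ∈ Piece 𝒫 (index (enum n))
    label≡⇒∈Piece {x} refl =
      subst (λ i → x ∈ Piece 𝒫 i) (sym (proj₁ (label-isLeast x))) (proj₂ (covering 𝒫 x))

theorem5p6 : ∀ {ℓ} (u : Ultrafilter ℤ ℓ) → Nonprincipal u → ℤ-Ramsey u → P-Point u → Selective u
theorem5p6 u u-nonprincipal ramsey pp = u-nonprincipal , λ 𝒫 → select 𝒫 (proj₂ pp (label u 𝒫))
  where
  select : ∀ 𝒫 → ∃[ A ] (A ∈ sets u × (ConstantOn (label u 𝒫) A ⊎ FiniteToOneOn (label u 𝒫) A)) →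
    (∃[ i ] Piece 𝒫 i ∈ sets u) ⊎
    (∃[ A ] (A ∈ sets u × ∀ i → AtMostOne (A ∩ Piece 𝒫 i)))
  select 𝒫 (A , A∈u , inj₁ (n , const)) =
    inj₁ (_ , upward u (λ {x} x∈A → label≡⇒∈Piece u 𝒫 (const x x∈A)) A∈u)
  select 𝒫 (A , A∈u , inj₂ fin) with B , B∈u , inj ← injectiveOn u ramsey pp A∈u fin =
    inj₂ (B , B∈u , λ i x y (x∈B , x∈i) (y∈B , y∈i) → inj x y x∈B y∈B
      (label-cong u 𝒫 (trans (∈Piece⇒index≡ u 𝒫 x∈i) (sym (∈Piece⇒index≡ u 𝒫 y∈i)))))
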